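{- Let $\pi\in S_k$ be a permutation such that the entries $1$ and $2$ are not in adjacent positions (i.e. $|\pi^{ -1}(1)-\pi^{ -1}(2)|\ge 2$). Let $\pi'\in S_{k-2}$ be the permutation obtained by removing the entries $1$ and $2$ from the sequence $\pi(1),\dots,\pi(k)$ and then normalizing. Then for every integer $n>1$, $$g(\pi,n)\le 42(\log_2 n)\cdot g(\pi',n).$$
   Context: For $\sigma\in S_m$, a $\sigma$-wave is an increasing sequence of integers $x_1<\cdots<x_{m+1}$ such that for all $1\le i,j\le m$, $x_{i+1}-x_i > x_{j+1}-x_j$ if and only if $\sigma(i)>\sigma(j)$. $g(\sigma,n)$ is the largest cardinality of a subset of $[n]=\{1,\dots,n\}$ containing no $\sigma$-wave. The normalization of a sequence of distinct integers $y_1,\dots,y_m$ is the unique $\tau\in S_m$ with $\tau(i)>\tau(j)$ iff $y_i>y_j$. -}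

module Defs where

open import Data.Nat using (ℕ; zero; suc; _+_; _*_; _∸_; _^_; _≤_; _<_; _≤?_; ∣_-_∣)
open import Data.Fin as Fin using (Fin; toℕ; inject₁; cast)
open import Data.Fin.Subset using (Subset; _∈_; ∣_∣)
open import Data.Fin.Permutation using (Permutation′; _⟨$⟩ʳ_; _⟨$⟩ˡ_)
open import Data.List using (List; length; lookup; map; filter; allFin)
open import Data.Product using (Σ; ∃; _×_; _,_)
open import Function.Bundles using (_⇔_)
open import Relation.Nullary using (¬_)
open import Relation.Binary.PropositionalEquality using (_≡_; sym)

-- Permutations σ ∈ S_m are `Permutation′ m`; the value σ(i) (1-based in the
-- paper) is `toℕ (σ ⟨$⟩ʳ i) + 1`, positions likewise 0-based.

IsWave : {m : ℕ} → Permutation′ m → (Fin (suc m) → ℕ) → Set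
IsWave {m} σ x =
  (∀ (i : Fin m) → x (inject₁ i) < x (Fin.suc i)) ×
  (∀ (i j : Fin m) →
     (gap j < gap i) ⇔ (toℕ (σ ⟨$⟩ʳ j) < toℕ (σ ⟨$⟩ʳ i)))
  where
  gap : Fin m → ℕ
  gap i = x (Fin.suc i) ∸ x (inject₁ i)

-- A subset S of [n] = {1,…,n}; the element j : Fin n stands for the integer toℕ j + 1
-- (a uniform shift, which does not affect increasingness or gaps).
ContainsWave : {m : ℕ} → Permutation′ m → (n : ℕ) → Subset n → Set
ContainsWave {m} σ n S =
  Σ (Fin (suc m) → Fin n) λ x → (∀ i → x i ∈ S) × IsWave σ (λ i → suc (toℕ (x i)))

IsG : {m : ℕ} → Permutation′ m → ℕ → ℕ → Set
IsG σ n g =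
  (Σ (Subset n) λ S → ¬ ContainsWave σ n S × ∣ S ∣ ≡ g) ×
  (∀ (S : Subset n) → ¬ ContainsWave σ n S → ∣ S ∣ ≤ g)

-- The sequence π(1),…,π(k) with entries 1 and 2 removed (0-based values ≥ 2 kept),
-- as a list of values in order of position.
removeOneTwo : {k : ℕ} → Permutation′ k → List ℕ
removeOneTwo {k} π = filter (2 ≤?_) (map (λ i → toℕ (π ⟨$⟩ʳ i)) (allFin k))

IsNormalization : {m : ℕ} → Permutation′ m → List ℕ → Set
IsNormalization {m} τ ys =
  Σ (length ys ≡ m) λ eq →
    ∀ (i j : Fin m) →
      (toℕ (τ ⟨$⟩ʳ j) < toℕ (τ ⟨$⟩ʳ i)) ⇔
      (lookup ys (cast (sym eq) j) < lookup ys (cast (sym eq) i))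

-- Entries 1 and 2 (0-based values 0 and 1) of π ∈ S_{k+2} are not adjacent.
OneTwoNonAdjacent : {k : ℕ} → Permutation′ (suc (suc k)) → Set
OneTwoNonAdjacent π =
  2 ≤ ∣ toℕ (π ⟨$⟩ˡ Fin.zero) - toℕ (π ⟨$⟩ˡ Fin.suc Fin.zero) ∣

{-# OPTIONS --safe #-}

-- Cut a set S avoiding π into triples x < y < z of consecutive elements, and sort the triples by
-- the dyadic scale d = 2^j ≤ z − x < 2d and by the residue r of ⌊x/d⌋ modulo 6.  Within one class
-- each triple lies in a window [rd + 6du, rd + 6du + 3d), and different triples have different u.
-- The u of one class avoid π′: in a π′-wave of windows every gap exceeds 3d, and the gaps are
-- ordered as the u-gaps whichever points represent the windows, so one can represent one window
-- by a pair of its triple at distance < d (the gap ranked 1) and another one by its extreme points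
-- (the gap ranked 2); that 1 and 2 are not adjacent makes these two windows different.
-- So each of the 6(⌊log₂ n⌋ + 1) classes has at most g(π′, n) triples, and at most two elements of S
-- are in no triple.
module Submission where

open import Defs
open import Data.Fin as Fin using (Fin; toℕ; inject₁; fromℕ<)
import Data.Fin.Properties as Finₚ
open import Data.Fin.Permutation using (Permutation′; _⟨$⟩ʳ_; _⟨$⟩ˡ_; inverseʳ; inverseˡ)
open import Data.Fin.Subset using (Subset; inside; outside; _∈_; ∣_∣; ⊥; ⁅_⁆; _∪_) renaming (_-_ to _∖_)
open import Data.Fin.Subset.Properties
  using (∉⊥; x∈⁅x⁆; x∈⁅y⁆⇒x≡y; ∣⁅x⁆∣≡1; p⊆p∪q; q⊆p∪q; x∈p∪q⁻; x∈p∧x≢y⇒x∈p-y; x∈p⇒∣p-x∣<∣p∣)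
open import Data.List using (List; []; _∷_; length; map; filter; lookup; tabulate; foldr)
open import Data.List.Membership.Propositional using () renaming (_∈_ to _∈ˡ_)
open import Data.List.Properties using (length-map; map-tabulate)
import Data.List.Relation.Binary.Sublist.Propositional.Properties as Sublistₚ
open import Data.List.Relation.Unary.All as All using (All; []; _∷_)
import Data.List.Relation.Unary.All.Properties as Allₚ
open import Data.List.Relation.Unary.AllPairs as AllPairs using (AllPairs; []; _∷_)
import Data.List.Relation.Unary.AllPairs.Properties as AllPairsₚ
open import Data.List.Relation.Unary.Any using (here; there)
open import Data.Nat using
  (ℕ; zero; suc; _+_; _*_; _∸_; _^_; _/_; _%_; _≤_; _<_; z≤n; s≤s; z<s; s≤s⁻¹; ∣_-_∣; _≟_; _≤?_; _<?_; NonZero; >-nonZero)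
open import Data.Nat.DivMod using (m≡m%n+[m/n]*n; m%n<n; m/n≤m; m/n*n≤m)
open import Data.Nat.Properties
open import Data.Nat.Tactic.RingSolver using (solve-∀)
open import Data.Product using (∃; _×_; _,_; proj₁; proj₂)
open import Data.Sum using (inj₁; inj₂)
open import Data.Vec using ([]; _∷_; here; there)
open import Function using (_∘_; id; Equivalence; mk⇔)
open import Level using (Level)
open import Relation.Binary using (tri<; tri≈; tri>)
open import Relation.Binary.PropositionalEquality using (_≡_; _≢_; refl; sym; trans; cong; cong₂; subst; subst₂)
open import Relation.Nullary using (¬_; yes; no; contradiction; ¬?)
open import Relation.Unary using (Pred; Decidable)

open Equivalence using (from)

private variable
  ℓ : Level
  X : Set ℓ
  k m n : ℕ

-- Counting a list class by class.

length-filter-split : {P : Pred X ℓ} (P? : Decidable P) (xs : List X) →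
  length xs ≡ length (filter P? xs) + length (filter (¬? ∘ P?) xs)
length-filter-split P? [] = refl
length-filter-split P? (x ∷ xs) with P? x
... | yes _ = cong suc (length-filter-split P? xs)
... | no  _ = trans (cong suc (length-filter-split P? xs)) (sym (+-suc _ _))

-- Induction on the number of classes: split off the class with the top value of `κ`. The classes of
-- what remains are sublists of the original ones, so the bound `b` persists.
pigeonhole : (N b : ℕ) (κ : X → ℕ) (xs : List X) → All (λ x → κ x < N) xs →
  (∀ c → length (filter (λ x → κ x ≟ c) xs) ≤ b) → length xs ≤ N * b
pigeonhole zero b κ [] [] small = z≤n
pigeonhole (suc N) b κ xs κ<1+N small = begin
  length xs                                              ≡⟨ length-filter-split top? xs ⟩
  length (filter top? xs) + length (filter (¬? ∘ top?) xs) ≤⟨ +-mono-≤ (small N) rest≤ ⟩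
  b + N * b                                              ∎
  where
  open ≤-Reasoning
  top? = λ x → κ x ≟ N
  rest = filter (¬? ∘ top?) xs
  rest≤ : length rest ≤ N * b
  rest≤ = pigeonhole N b κ rest
    (All.zipWith (λ (≢N , <1+N) → ≤∧≢⇒< (s≤s⁻¹ <1+N) ≢N)
      (Allₚ.all-filter (¬? ∘ top?) xs , Allₚ.filter⁺ (¬? ∘ top?) κ<1+N))
    (λ c → ≤-trans
      (Sublistₚ.length-mono-≤ (Sublistₚ.filter⁺ (λ x → κ x ≟ c) (λ x → κ x ≟ c) (λ { refl κx≡c → κx≡c })
        (Sublistₚ.filter-⊆ (¬? ∘ top?) xs)))
      (small c))

-- Subsets of `Fin n` as increasing lists, and back.

elements : Subset n → List (Fin n)
elements [] = []
elements (outside ∷ S) = map Fin.suc (elements S)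
elements (inside  ∷ S) = Fin.zero ∷ map Fin.suc (elements S)

length-elements : (S : Subset n) → length (elements S) ≡ ∣ S ∣
length-elements [] = refl
length-elements (outside ∷ S) = trans (length-map Fin.suc (elements S)) (length-elements S)
length-elements (inside  ∷ S) = cong suc (trans (length-map Fin.suc (elements S)) (length-elements S))

elements-sorted : (S : Subset n) → AllPairs Fin._<_ (elements S)
elements-sorted [] = []
elements-sorted (outside ∷ S) = AllPairsₚ.map⁺ (AllPairs.map s≤s (elements-sorted S))
elements-sorted (inside  ∷ S) =
  Allₚ.map⁺ (All.universal (λ _ → z<s) (elements S)) ∷
  AllPairsₚ.map⁺ (AllPairs.map s≤s (elements-sorted S))

elements-∈ : (S : Subset n) → All (_∈ S) (elements S)
elements-∈ [] = []
elements-∈ (outside ∷ S) = Allₚ.map⁺ (All.map there (elements-∈ S))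
elements-∈ (inside  ∷ S) = here ∷ Allₚ.map⁺ (All.map there (elements-∈ S))

fromElements : List (Fin n) → Subset n
fromElements = foldr (λ x S → ⁅ x ⁆ ∪ S) ⊥

∈-fromElements⁺ : (xs : List (Fin n)) → All (_∈ fromElements xs) xs
∈-fromElements⁺ [] = []
∈-fromElements⁺ (x ∷ xs) =
  p⊆p∪q _ (x∈⁅x⁆ x) ∷ All.map (q⊆p∪q _ _) (∈-fromElements⁺ xs)

∈-fromElements⁻ : (f : X → Fin n) (xs : List X) {u : Fin n} →
  u ∈ fromElements (map f xs) → ∃ λ x → x ∈ˡ xs × f x ≡ u
∈-fromElements⁻ f [] u∈ = contradiction u∈ ∉⊥
∈-fromElements⁻ f (x ∷ xs) u∈ with x∈p∪q⁻ ⁅ f x ⁆ (fromElements (map f xs)) u∈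
... | inj₁ u∈⁅fx⁆ = x , here refl , sym (x∈⁅y⁆⇒x≡y (f x) u∈⁅fx⁆)
... | inj₂ u∈xs = let (y , y∈ , fy≡u) = ∈-fromElements⁻ f xs u∈xs in y , there y∈ , fy≡u

unique⇒length≤∣S∣ : (S : Subset n) (xs : List (Fin n)) →
  AllPairs _≢_ xs → All (_∈ S) xs → length xs ≤ ∣ S ∣
unique⇒length≤∣S∣ S [] _ _ = z≤n
unique⇒length≤∣S∣ S (x ∷ xs) (x≢ ∷ xs!) (x∈S ∷ xs∈S) = ≤-trans
  (s≤s (unique⇒length≤∣S∣ (S ∖ x) xs xs!
    (All.zipWith (λ (x≢y , y∈S) → x∈p∧x≢y⇒x∈p-y y∈S (x≢y ∘ sym)) (x≢ , xs∈S))))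
  (x∈p⇒∣p-x∣<∣p∣ x∈S)

-- Consecutive triples and dyadic scales.

record Triple (S : Subset n) : Set where
  constructor triple
  field
    {x y z}     : Fin n
    x∈S         : x ∈ S
    y∈S         : y ∈ S
    z∈S         : z ∈ S
    x<y         : x Fin.< y
    y<z         : y Fin.< z

  spread : ℕ
  spread = toℕ z ∸ toℕ x

_≺_ : {S : Subset n} → Triple S → Triple S → Set
s ≺ t = Triple.z s Fin.< Triple.x t

triples : {S : Subset n} (xs : List (Fin n)) → AllPairs Fin._<_ xs → All (_∈ S) xs → List (Triple S)
triples (x ∷ y ∷ z ∷ xs) ((x<y ∷ _) ∷ (y<z ∷ _) ∷ _ ∷ xs!) (x∈ ∷ y∈ ∷ z∈ ∷ xs∈) =
  triple x∈ y∈ z∈ x<y y<z ∷ triples xs xs! xs∈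
-- At most two elements are left over here; they are dropped and account for the additive 2 in the
-- count.
triples _ _ _ = []

length≤triples : {S : Subset n} (xs : List (Fin n)) (xs! : AllPairs Fin._<_ xs) (xs∈ : All (_∈ S) xs) →
  length xs ≤ 2 + length (triples xs xs! xs∈) * 3
length≤triples [] _ _ = z≤n
length≤triples (x ∷ []) _ _ = s≤s z≤n
length≤triples (x ∷ y ∷ []) _ _ = ≤-refl
length≤triples (x ∷ y ∷ z ∷ xs) ((_ ∷ _) ∷ (_ ∷ _) ∷ _ ∷ xs!) (_ ∷ _ ∷ _ ∷ xs∈) =
  s≤s (s≤s (s≤s (length≤triples xs xs! xs∈)))

triples-above : {S : Subset n} {w : Fin n} (xs : List (Fin n)) (xs! : AllPairs Fin._<_ xs) (xs∈ : All (_∈ S) xs) →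
  All (w Fin.<_) xs → All (λ t → w Fin.< Triple.x t) (triples xs xs! xs∈)
triples-above [] _ _ _ = []
triples-above (x ∷ []) _ _ _ = []
triples-above (x ∷ y ∷ []) _ _ _ = []
triples-above (x ∷ y ∷ z ∷ xs) ((_ ∷ _) ∷ (_ ∷ _) ∷ _ ∷ xs!) (_ ∷ _ ∷ _ ∷ xs∈) (w<x ∷ _ ∷ _ ∷ w<xs) =
  w<x ∷ triples-above xs xs! xs∈ w<xs

triples-sorted : {S : Subset n} (xs : List (Fin n)) (xs! : AllPairs Fin._<_ xs) (xs∈ : All (_∈ S) xs) →
  AllPairs _≺_ (triples xs xs! xs∈)
triples-sorted [] _ _ = []
triples-sorted (x ∷ []) _ _ = []
triples-sorted (x ∷ y ∷ []) _ _ = []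
triples-sorted (x ∷ y ∷ z ∷ xs) ((_ ∷ _) ∷ (_ ∷ _) ∷ z< ∷ xs!) (_ ∷ _ ∷ _ ∷ xs∈) =
  triples-above xs xs! xs∈ z< ∷ triples-sorted xs xs! xs∈

-- The exponent is ⌊log₂ n⌋. It serves twice: as the scale of a triple, and for the logarithm in the
-- final bound.
dyadic : (n : ℕ) → 0 < n → ∃ λ j → 2 ^ j ≤ n × n < 2 ^ suc j
dyadic (suc zero) _ = 0 , ≤-refl , ≤-refl
dyadic (suc n@(suc _)) _ with dyadic n z<s
... | j , 2^j≤n , n<2^[1+j] with suc n <? 2 ^ suc j
...   | yes 1+n<2^[1+j] = j , m≤n⇒m≤1+n 2^j≤n , 1+n<2^[1+j]
-- Both bounds together force `suc n` to equal `2 ^ suc j`, so the exponent goes up by one exactly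
-- at a power of two.
...   | no  1+n≮2^[1+j] = suc j , ≮⇒≥ 1+n≮2^[1+j] ,
          ≤-<-trans n<2^[1+j] (^-monoʳ-< 2 ≤-refl (n<1+n (suc j)))

-- Positions after the deletion of entries.

module _ {P : Pred X ℓ} (P? : Decidable P) where

  -- The arguments are the `suc m` points around `m` gaps. The rank of a point counts the accepted
  -- gaps before it, so contracting every rejected gap sends the point to its rank.
  rank : (f : Fin m → X) → Fin (suc m) → Fin (suc (length (filter P? (tabulate f))))
  rank f Fin.zero = Fin.zero
  rank {suc m} f (Fin.suc i) with P? (f Fin.zero)
  ... | yes _ = Fin.suc (rank (f ∘ Fin.suc) i)
  ... | no  _ = rank (f ∘ Fin.suc) i

  rank-rejected : (f : Fin m → X) (g : Fin m) → ¬ P (f g) → rank f (inject₁ g) ≡ rank f (Fin.suc g)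
  rank-rejected f Fin.zero ¬p with P? (f Fin.zero)
  ... | yes p = contradiction p ¬p
  ... | no  _ = refl
  rank-rejected f (Fin.suc g) ¬p with P? (f Fin.zero)
  ... | yes _ = cong Fin.suc (rank-rejected (f ∘ Fin.suc) g ¬p)
  ... | no  _ = rank-rejected (f ∘ Fin.suc) g ¬p

  rank-accepted : (f : Fin m → X) (g : Fin m) → P (f g) →
    ∃ λ r → rank f (inject₁ g) ≡ inject₁ r × rank f (Fin.suc g) ≡ Fin.suc r ×
            lookup (filter P? (tabulate f)) r ≡ f g
  rank-accepted f Fin.zero p with P? (f Fin.zero)
  ... | yes _ = Fin.zero , refl , refl , refl
  ... | no ¬p = contradiction p ¬p
  rank-accepted f (Fin.suc g) p with P? (f Fin.zero) | rank-accepted (f ∘ Fin.suc) g p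
  ... | yes _ | r , eq₁ , eq₂ , eq₃ = Fin.suc r , cong Fin.suc eq₁ , cong Fin.suc eq₂ , eq₃
  ... | no  _ | r , eq₁ , eq₂ , eq₃ = r , eq₁ , eq₂ , eq₃

-- Periodic windows and the gaps between them.

gap : (Fin (suc m) → ℕ) → Fin m → ℕ
gap x i = x (Fin.suc i) ∸ x (inject₁ i)

-- The windows have length `E` and recur with period `2 * E` from the offset `o`, which leaves free
-- space of length `E` after each of them.
InWindow : (o E u p : ℕ) → Set
InWindow o E u p = o + u * (2 * E) ≤ p × p < o + u * (2 * E) + E

module _ {o E : ℕ} where

  private
    base : ℕ → ℕ
    base u = o + u * (2 * E)

    base-+ : ∀ w u → base (w + u) ≡ base u + w * (2 * E)
    base-+ w u = lemma o w u (2 * E)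
      where
      lemma : ∀ o w u t → o + (w + u) * t ≡ o + u * t + w * t
      lemma = solve-∀

    base-∸ : ∀ {u u′} → u ≤ u′ → base u′ ≡ base u + (u′ ∸ u) * (2 * E)
    base-∸ {u} {u′} u≤u′ = trans (cong base (sym (m∸n+n≡m u≤u′))) (base-+ (u′ ∸ u) u)

  open ≤-Reasoning

  sameWindow-gap< : ∀ {u p q} → InWindow o E u p → InWindow o E u q → p < q → q ∸ p < E
  sameWindow-gap< {u} {p} {q} (B≤p , _) (_ , q<B+E) p<q =
    +-cancelʳ-< p (q ∸ p) E (begin-strict
      q ∸ p + p  ≡⟨ m∸n+n≡m (<⇒≤ p<q) ⟩
      q          <⟨ q<B+E ⟩
      base u + E ≤⟨ +-monoˡ-≤ E B≤p ⟩
      p + E      ≡⟨ +-comm p E ⟩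
      E + p      ∎)

  module _ {u u′ p q} (u<u′ : u < u′) (p∈ : InWindow o E u p) (q∈ : InWindow o E u′ q) where

    private
      w = u′ ∸ u

      2E≤w*2E : 2 * E ≤ w * (2 * E)
      2E≤w*2E = m≤n*m (2 * E) w {{>-nonZero (m<n⇒0<n∸m u<u′)}}

    windows-< : p < q
    windows-< = begin-strict
      p                  <⟨ proj₂ p∈ ⟩
      base u + E         ≤⟨ +-monoʳ-≤ (base u) (m≤m+n E (E + 0)) ⟩
      base u + 2 * E     ≤⟨ +-monoʳ-≤ (base u) 2E≤w*2E ⟩
      base u + w * (2 * E) ≡⟨ base-∸ (<⇒≤ u<u′) ⟨
      base u′            ≤⟨ proj₁ q∈ ⟩
      q                  ∎

    windows-gap-upper : q ∸ p < w * (2 * E) + E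
    windows-gap-upper = +-cancelʳ-< p (q ∸ p) _ (begin-strict
      q ∸ p + p                ≡⟨ m∸n+n≡m (<⇒≤ windows-<) ⟩
      q                        <⟨ proj₂ q∈ ⟩
      base u′ + E              ≡⟨ cong (_+ E) (base-∸ (<⇒≤ u<u′)) ⟩
      base u + w * (2 * E) + E ≤⟨ +-monoˡ-≤ E (+-monoˡ-≤ (w * (2 * E)) (proj₁ p∈)) ⟩
      p + w * (2 * E) + E      ≡⟨ lemma p (w * (2 * E)) E ⟩
      w * (2 * E) + E + p      ∎)
      where
      lemma : ∀ p t e → p + t + e ≡ t + e + p
      lemma = solve-∀

    -- The starts of the windows differ by `w * (2 * E)`, and `p` lies less than `E` after the start
    -- of its own. The term `E` stands on the right to avoid truncated subtraction.
    windows-gap-lower : w * (2 * E) < q ∸ p + E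
    windows-gap-lower = +-cancelʳ-< p _ _ (begin-strict
      w * (2 * E) + p            <⟨ +-monoʳ-< (w * (2 * E)) (proj₂ p∈) ⟩
      w * (2 * E) + (base u + E) ≡⟨ lemma₁ (w * (2 * E)) (base u) E ⟩
      base u + w * (2 * E) + E   ≡⟨ cong (_+ E) (base-∸ (<⇒≤ u<u′)) ⟨
      base u′ + E                ≤⟨ +-monoˡ-≤ E (proj₁ q∈) ⟩
      q + E                      ≡⟨ cong (_+ E) (m∸n+n≡m (<⇒≤ windows-<)) ⟨
      q ∸ p + p + E              ≡⟨ lemma₂ (q ∸ p) p E ⟩
      q ∸ p + E + p              ∎)
      where
      lemma₁ : ∀ t b e → t + (b + e) ≡ b + t + e
      lemma₁ = solve-∀
      lemma₂ : ∀ g p e → g + p + e ≡ g + e + p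
      lemma₂ = solve-∀

    E<windows-gap : E < q ∸ p
    E<windows-gap = +-cancelʳ-< E E (q ∸ p) (begin-strict
      E + E       ≡⟨ cong (E +_) (+-identityʳ E) ⟨
      2 * E       ≤⟨ 2E≤w*2E ⟩
      w * (2 * E) <⟨ windows-gap-lower ⟩
      q ∸ p + E   ∎)

  -- A gap between windows at index distance w lies strictly within `E` of w · 2E. For different w
  -- these ranges are disjoint, whichever points represent the windows.
  windows-gap-mono : ∀ {u u′ p q v v′ r s} → u < u′ → v < v′ →
    InWindow o E u p → InWindow o E u′ q → InWindow o E v r → InWindow o E v′ s →
    u′ ∸ u < v′ ∸ v → q ∸ p < s ∸ r
  windows-gap-mono {u} {u′} {p} {q} {v} {v′} {r} {s} u<u′ v<v′ p∈ q∈ r∈ s∈ w<w′ =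
    +-cancelʳ-< E (q ∸ p) (s ∸ r) (begin-strict
      q ∸ p + E                    <⟨ +-monoˡ-< E (windows-gap-upper u<u′ p∈ q∈) ⟩
      (u′ ∸ u) * (2 * E) + E + E   ≡⟨ lemma (u′ ∸ u) E ⟩
      suc (u′ ∸ u) * (2 * E)       ≤⟨ *-monoˡ-≤ (2 * E) w<w′ ⟩
      (v′ ∸ v) * (2 * E)           <⟨ windows-gap-lower v<v′ r∈ s∈ ⟩
      s ∸ r + E                    ∎)
    where
    lemma : ∀ w e → w * (2 * e) + e + e ≡ suc w * (2 * e)
    lemma = solve-∀

-- Expanding a wave of windows.

data Role : Set where
  first last low high : Role

-- The four roles are names for two pairs of points, not four different points: a triple fills them
-- with its three elements, and the pairs overlap.
record Cluster (S : Subset n) (d o E u : ℕ) : Set where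
  field
    point    : Role → Fin n
    point∈   : ∀ r → point r ∈ S
    inWindow : ∀ r → InWindow o E u (toℕ (point r))
    low<high : point low Fin.< point high
    short    : toℕ (point high) ∸ toℕ (point low) < d
    first<last : point first Fin.< point last
    long     : d ≤ toℕ (point last) ∸ toℕ (point first)

-- Gap `a` has end points `a` and `suc a`, so the three inequalities say that gaps `a` and `b` have
-- no common end point and their roles cannot clash.
apart⇒≢ : ∀ a b → 2 ≤ ∣ a - b ∣ → a ≢ b × a ≢ suc b × suc a ≢ b
apart⇒≢ a b 2≤ =
  (λ { refl → contradiction (subst (2 ≤_) (∣n-n∣≡0 a) 2≤) λ () }) ,
  (λ { refl → contradiction (subst (2 ≤_) (∣1+n-n∣≡1 b) 2≤) λ { (s≤s ()) } }) ,
  (λ { refl → contradiction (subst (2 ≤_) (trans (∣-∣-comm a (suc a)) (∣1+n-n∣≡1 a)) 2≤) λ { (s≤s ()) } })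
  where
  ∣1+n-n∣≡1 : ∀ n → ∣ suc n - n ∣ ≡ 1
  ∣1+n-n∣≡1 zero    = refl
  ∣1+n-n∣≡1 (suc n) = ∣1+n-n∣≡1 n

-- Here `f` lists the values of π, and `u` gives the window indices of a wave for the filtered
-- values. Indexing `u` by the length of the filtered list keeps casts out of the construction.
module Expansion
  (f : Fin m → ℕ) (f-injective : ∀ {g h} → f g ≡ f h → g ≡ h)
  {P Q : Fin m} (fP≡0 : f P ≡ 0) (fQ≡1 : f Q ≡ 1) (apart : 2 ≤ ∣ toℕ P - toℕ Q ∣)
  {S : Subset n} {d o E : ℕ}
  (u : Fin (suc (length (filter (2 ≤?_) (tabulate f)))) → ℕ)
  (u-increasing : ∀ i → u (inject₁ i) < u (Fin.suc i))
  (u-gaps : ∀ i j → lookup (filter (2 ≤?_) (tabulate f)) j < lookup (filter (2 ≤?_) (tabulate f)) i →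
            gap u j < gap u i)
  (clusters : ∀ i → Cluster S d o E (u i))
  where

  open Cluster

  private
    P≢Q = proj₁ (apart⇒≢ (toℕ P) (toℕ Q) apart)
    P≢1+Q = proj₁ (proj₂ (apart⇒≢ (toℕ P) (toℕ Q) apart))
    1+P≢Q = proj₂ (proj₂ (apart⇒≢ (toℕ P) (toℕ Q) apart))

    suc≢inject₁ : ∀ (i : Fin m) → Fin.suc i ≢ inject₁ i
    suc≢inject₁ i eq = 1+n≢n (trans (cong toℕ eq) (Finₚ.toℕ-inject₁ i))

    inject₁≡suc⇒ : ∀ {i j : Fin m} → inject₁ i ≡ Fin.suc j → toℕ i ≡ suc (toℕ j)
    inject₁≡suc⇒ {i} eq = trans (sym (Finₚ.toℕ-inject₁ i)) (cong toℕ eq)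

  role : Fin (suc m) → Role
  role i with i Finₚ.≟ inject₁ P | i Finₚ.≟ Fin.suc P | i Finₚ.≟ Fin.suc Q
  ... | yes _ | _ | _ = low
  ... | no _ | yes _ | _ = high
  ... | no _ | no _ | yes _ = last
  -- This default also covers the left end of gap `Q`, where `first` is required. At all other
  -- points that reach it any role would do, because their gaps are controlled by windows alone.
  ... | no _ | no _ | no _ = first

  role-P : role (inject₁ P) ≡ low
  role-P with inject₁ P Finₚ.≟ inject₁ P
  ... | yes _ = refl
  ... | no ≢ = contradiction refl ≢

  role-sucP : role (Fin.suc P) ≡ high
  role-sucP with Fin.suc P Finₚ.≟ inject₁ P | Fin.suc P Finₚ.≟ Fin.suc P
  ... | yes eq | _ = contradiction eq (suc≢inject₁ P)
  ... | no _ | yes _ = refl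
  ... | no _ | no ≢ = contradiction refl ≢

  role-Q : role (inject₁ Q) ≡ first
  role-Q with inject₁ Q Finₚ.≟ inject₁ P | inject₁ Q Finₚ.≟ Fin.suc P | inject₁ Q Finₚ.≟ Fin.suc Q
  ... | yes eq | _ | _ = contradiction (cong toℕ (sym (Finₚ.inject₁-injective eq))) P≢Q
  ... | no _ | yes eq | _ = contradiction (sym (inject₁≡suc⇒ eq)) 1+P≢Q
  ... | no _ | no _ | yes eq = contradiction (sym eq) (suc≢inject₁ Q)
  ... | no _ | no _ | no _ = refl

  role-sucQ : role (Fin.suc Q) ≡ last
  role-sucQ with Fin.suc Q Finₚ.≟ inject₁ P | Fin.suc Q Finₚ.≟ Fin.suc P | Fin.suc Q Finₚ.≟ Fin.suc Q
  ... | yes eq | _ | _ = contradiction (inject₁≡suc⇒ (sym eq)) P≢1+Q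
  ... | no _ | yes eq | _ = contradiction (cong toℕ (sym (Finₚ.suc-injective eq))) P≢Q
  ... | no _ | no _ | yes _ = refl
  ... | no _ | no _ | no ≢ = contradiction refl ≢

  ρ = rank (2 ≤?_) f

  -- The rank does not change across the gaps `P` and `Q`, so each of them has both ends in one
  -- cluster, and the roles pick the short or the long pair there. Every other gap leads to the next
  -- window.
  x : Fin (suc m) → Fin n
  x i = point (clusters (ρ i)) (role i)

  x∈S : ∀ i → x i ∈ S
  x∈S i = point∈ (clusters (ρ i)) (role i)

  x-inWindow : ∀ i → InWindow o E (u (ρ i)) (toℕ (x i))
  x-inWindow i = inWindow (clusters (ρ i)) (role i)

  data Gap (g : Fin m) : Set where
    shortest : f g ≡ 0 → x (inject₁ g) Fin.< x (Fin.suc g) → gap (toℕ ∘ x) g < d → Gap g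
    second   : f g ≡ 1 → x (inject₁ g) Fin.< x (Fin.suc g) → d ≤ gap (toℕ ∘ x) g → Gap g
    coarse   : ∀ r → 2 ≤ f g → lookup (filter (2 ≤?_) (tabulate f)) r ≡ f g →
               InWindow o E (u (inject₁ r)) (toℕ (x (inject₁ g))) →
               InWindow o E (u (Fin.suc r)) (toℕ (x (Fin.suc g))) → Gap g

  gap-cases : ∀ g → Gap g
  gap-cases g with f g in eq
  ... | 0 with refl ← f-injective (trans eq (sym fP≡0)) = shortest eq lt gp
    where
    c = clusters (ρ (Fin.suc P))
    -- The value 0 is filtered out, so both ends of the gap have the same rank and draw on the same
    -- cluster `c`.
    same : x (inject₁ P) ≡ point c low
    same = cong₂ (λ i r → point (clusters i) r)
      (rank-rejected (2 ≤?_) f P (λ 2≤ → contradiction (subst (2 ≤_) fP≡0 2≤) λ ())) role-P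
    same′ : x (Fin.suc P) ≡ point c high
    same′ = cong (point c) role-sucP
    lt : x (inject₁ P) Fin.< x (Fin.suc P)
    lt = subst₂ Fin._<_ (sym same) (sym same′) (low<high c)
    gp : gap (toℕ ∘ x) P < d
    gp = subst₂ (λ a b → toℕ b ∸ toℕ a < d) (sym same) (sym same′) (short c)
  ... | 1 with refl ← f-injective (trans eq (sym fQ≡1)) = second eq lt gp
    where
    c = clusters (ρ (Fin.suc Q))
    same : x (inject₁ Q) ≡ point c first
    same = cong₂ (λ i r → point (clusters i) r)
      (rank-rejected (2 ≤?_) f Q (λ 2≤ → contradiction (subst (2 ≤_) fQ≡1 2≤) λ { (s≤s ()) })) role-Q
    same′ : x (Fin.suc Q) ≡ point c last
    same′ = cong (point c) role-sucQ
    lt : x (inject₁ Q) Fin.< x (Fin.suc Q)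
    lt = subst₂ Fin._<_ (sym same) (sym same′) (first<last c)
    gp : d ≤ gap (toℕ ∘ x) Q
    gp = subst₂ (λ a b → d ≤ toℕ b ∸ toℕ a) (sym same) (sym same′) (long c)
  ... | suc (suc v) =
    let 2≤fg = subst (2 ≤_) (sym eq) (s≤s (s≤s z≤n))
        (r , eq₁ , eq₂ , eq₃) = rank-accepted (2 ≤?_) f g 2≤fg
    in coarse r 2≤fg eq₃
         (subst (λ i → InWindow o E (u i) (toℕ (x (inject₁ g)))) eq₁ (x-inWindow (inject₁ g)))
         (subst (λ i → InWindow o E (u i) (toℕ (x (Fin.suc g)))) eq₂ (x-inWindow (Fin.suc g)))

  same-cluster : ∀ g → f g < 2 → u (ρ (inject₁ g)) ≡ u (ρ (Fin.suc g))
  same-cluster g f<2 = cong u (rank-rejected (2 ≤?_) f g (<⇒≱ f<2))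

  gap<E : ∀ g → f g < 2 → x (inject₁ g) Fin.< x (Fin.suc g) → gap (toℕ ∘ x) g < E
  gap<E g f<2 = sameWindow-gap< {o} {u = u (ρ (Fin.suc g))}
    (subst (λ v → InWindow o E v (toℕ (x (inject₁ g)))) (same-cluster g f<2) (x-inWindow (inject₁ g)))
    (x-inWindow (Fin.suc g))

  x-increasing : ∀ g → x (inject₁ g) Fin.< x (Fin.suc g)
  x-increasing g with gap-cases g
  ... | shortest _ lt _ = lt
  ... | second _ lt _ = lt
  ... | coarse r _ _ p∈ q∈ = windows-< {o} (u-increasing r) p∈ q∈

  -- Three bands decide: the gap of value 0 is below `d`, that of value 1 is at least `d` and below
  -- `E`, and all others exceed `E`. Inside the last band the order comes from the window indices.
  gap-mono : ∀ h g → f h < f g → gap (toℕ ∘ x) h < gap (toℕ ∘ x) g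
  gap-mono h g fh<fg with gap-cases h | gap-cases g
  ... | _ | shortest fg≡0 _ _ = contradiction (subst (f h <_) fg≡0 fh<fg) n≮0
  ... | shortest fh≡0 _ gap<d | second fg≡1 _ d≤gap = <-≤-trans gap<d d≤gap
  ... | shortest fh≡0 lt _ | coarse r _ _ p∈ q∈ =
    <-trans (gap<E h (subst (_< 2) (sym fh≡0) z<s) lt) (E<windows-gap {o} (u-increasing r) p∈ q∈)
  ... | second fh≡1 _ _ | second fg≡1 _ _ = contradiction fh<fg (<-irrefl (trans fh≡1 (sym fg≡1)))
  ... | second fh≡1 lt _ | coarse r _ _ p∈ q∈ =
    <-trans (gap<E h (subst (_< 2) (sym fh≡1) ≤-refl) lt) (E<windows-gap {o} (u-increasing r) p∈ q∈)
  ... | coarse r _ eq p∈ q∈ | coarse r′ _ eq′ p′∈ q′∈ =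
    windows-gap-mono {o} (u-increasing r) (u-increasing r′) p∈ q∈ p′∈ q′∈
      (u-gaps r′ r (subst₂ _<_ (sym eq) (sym eq′) fh<fg))
  ... | coarse r 2≤fh _ _ _ | second fg≡1 _ _ =
    contradiction (≤-trans (s≤s 2≤fh) (subst (f h <_) fg≡1 fh<fg)) λ { (s≤s ()) }

-- From comparisons of gaps to waves of π.

values : Permutation′ m → Fin m → ℕ
values π i = toℕ (π ⟨$⟩ʳ i)

values-injective : (π : Permutation′ m) {g h : Fin m} → values π g ≡ values π h → g ≡ h
values-injective π eq =
  trans (sym (inverseˡ π)) (trans (cong (π ⟨$⟩ˡ_) (Finₚ.toℕ-injective eq)) (inverseˡ π))

-- One direction of the equivalence suffices: the values are distinct and totally ordered, so a
-- violation of the converse would reverse a comparison already known.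
order-preserving-gaps⇒IsWave : (π : Permutation′ m) (x : Fin (suc m) → ℕ) →
  (∀ i → x (inject₁ i) < x (Fin.suc i)) →
  (∀ h g → values π h < values π g → gap x h < gap x g) → IsWave π x
order-preserving-gaps⇒IsWave π x x↑ mono = x↑ , λ i j → mk⇔ (reflects i j) (mono j i)
  where
  reflects : ∀ i j → gap x j < gap x i → values π j < values π i
  reflects i j lt with <-cmp (values π j) (values π i)
  ... | tri< πj<πi _ _ = πj<πi
  ... | tri≈ _ πj≡πi _ with refl ← values-injective π πj≡πi = contradiction lt (<-irrefl refl)
  ... | tri> _ _ πi<πj = contradiction lt (<-asym (mono i j πi<πj))

expand-wave : (π : Permutation′ m) {P Q : Fin m} → values π P ≡ 0 → values π Q ≡ 1 →
  2 ≤ ∣ toℕ P - toℕ Q ∣ →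
  (π′ : Permutation′ k) → IsNormalization π′ (filter (2 ≤?_) (tabulate (values π))) →
  {S : Subset n} {d o E : ℕ} (y : Fin (suc k) → Fin n) → IsWave π′ (λ i → suc (toℕ (y i))) →
  (∀ i → Cluster S d o E (toℕ (y i))) → ContainsWave π n S
-- Matching `refl` makes `k` the length of the filtered list, and the casts in the normalization
-- become identities.
expand-wave π πP≡0 πQ≡1 apart π′ (refl , norm) y (y↑ , order) clusters =
  x , x∈S , order-preserving-gaps⇒IsWave π (suc ∘ toℕ ∘ x) (s≤s ∘ x-increasing) gap-mono
  where
  vs = filter (2 ≤?_) (tabulate (values π))
  y-gaps : ∀ i j → lookup vs j < lookup vs i → gap (toℕ ∘ y) j < gap (toℕ ∘ y) i
  -- The shift by `suc` in the wave cancels in the gaps by computation.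
  y-gaps i j lt = from (order i j) (from (norm i j)
    (subst₂ (λ a b → lookup vs a < lookup vs b)
      (sym (Finₚ.cast-is-id refl j)) (sym (Finₚ.cast-is-id refl i)) lt))
  open Expansion (values π) (values-injective π) πP≡0 πQ≡1 apart
    (toℕ ∘ y) (s≤s⁻¹ ∘ y↑) y-gaps clusters

expand-π′-wave : (π : Permutation′ (suc (suc k))) (π′ : Permutation′ k) →
  OneTwoNonAdjacent π → IsNormalization π′ (removeOneTwo π) →
  {S : Subset n} {d o E : ℕ} (y : Fin (suc k) → Fin n) → IsWave π′ (λ i → suc (toℕ (y i))) →
  (∀ i → Cluster S d o E (toℕ (y i))) → ContainsWave π n S
expand-π′-wave π π′ apart norm = expand-wave π
  (cong toℕ (inverseʳ π)) (cong toℕ (inverseʳ π)) apart π′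
  (subst (IsNormalization π′) (cong (filter (2 ≤?_)) (map-tabulate id (values π))) norm)

-- Cells of triples at one scale.

module _ {S : Subset n} (d : ℕ) .{{_ : NonZero d}} where

  -- With windows of length `3 * d` the period is six blocks of length `d`, hence the modulus 6. The
  -- residue of the block number fixes the offset, and its quotient is the window index.
  residue : Triple S → ℕ
  residue t = toℕ (Triple.x t) / d % 6

  -- The index is at most x, hence below `n`. Taking it in `Fin n` lets the bound for π′ apply to
  -- sets of cells.
  cell : Triple S → Fin n
  cell t = fromℕ< (≤-<-trans
    (≤-trans (m/n≤m (toℕ (Triple.x t) / d) 6) (m/n≤m (toℕ (Triple.x t)) d)) (Finₚ.toℕ<n (Triple.x t)))

  HasScale : Triple S → Set
  HasScale t = d ≤ Triple.spread t × Triple.spread t < 2 * d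

  open ≤-Reasoning

  toℕ-cell : ∀ t → toℕ (cell t) ≡ toℕ (Triple.x t) / d / 6
  toℕ-cell t = Finₚ.toℕ-fromℕ< _

  base-cell : ∀ t → residue t * d + toℕ (cell t) * (2 * (3 * d)) ≡ toℕ (Triple.x t) / d * d
  base-cell t = begin-equality
    residue t * d + toℕ (cell t) * (2 * (3 * d)) ≡⟨ cong (λ u → residue t * d + u * (2 * (3 * d))) (toℕ-cell t) ⟩
    q % 6 * d + q / 6 * (2 * (3 * d))            ≡⟨ lemma (q % 6) (q / 6) d ⟩
    (q % 6 + q / 6 * 6) * d                      ≡⟨ cong (_* d) (m≡m%n+[m/n]*n q 6) ⟨
    q * d                                        ∎
    where
    q = toℕ (Triple.x t) / d
    lemma : ∀ r u d → r * d + u * (2 * (3 * d)) ≡ (r + u * 6) * d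
    lemma = solve-∀

  x<[q+1]d : ∀ x → x < x / d * d + d
  x<[q+1]d x = begin-strict
    x                   ≡⟨ m≡m%n+[m/n]*n x d ⟩
    x % d + x / d * d   <⟨ +-monoˡ-< (x / d * d) (m%n<n x d) ⟩
    d + x / d * d       ≡⟨ +-comm d _ ⟩
    x / d * d + d       ∎

  -- The start of the block of x is at most x and more than x - d, and z < x + 2d; together they
  -- give the window length `3 * d`.
  inWindow-cell : ∀ t → HasScale t → ∀ p → toℕ (Triple.x t) ≤ p → p ≤ toℕ (Triple.z t) →
    InWindow (residue t * d) (3 * d) (toℕ (cell t)) p
  inWindow-cell t (_ , spread<2d) p x≤p p≤z rewrite base-cell t =
    ≤-trans (m/n*n≤m xₙ d) x≤p , (begin-strict
      p                          ≤⟨ p≤z ⟩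
      zₙ                         ≡⟨ m∸n+n≡m (≤-trans x≤p p≤z) ⟨
      (zₙ ∸ xₙ) + xₙ             <⟨ +-mono-< spread<2d (x<[q+1]d xₙ) ⟩
      2 * d + (xₙ / d * d + d)   ≡⟨ lemma (xₙ / d * d) d ⟩
      xₙ / d * d + 3 * d         ∎)
    where
    xₙ = toℕ (Triple.x t)
    zₙ = toℕ (Triple.z t)
    lemma : ∀ a d → 2 * d + (a + d) ≡ a + 3 * d
    lemma = solve-∀

  -- The differences y - x and z - y add up to less than 2d, so one of them is below `d` and
  -- provides the short pair; x and z are the long pair.
  cluster : ∀ t → HasScale t → Cluster S d (residue t * d) (3 * d) (toℕ (cell t))
  cluster t@(triple {x} {y} {z} x∈S y∈S z∈S x<y y<z) scale@(d≤spread , spread<2d)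
    with toℕ y ∸ toℕ x <? d
  ... | yes y∸x<d = record
    { point      = λ { first → x ; last → z ; low → x ; high → y }
    ; point∈     = λ { first → x∈S ; last → z∈S ; low → x∈S ; high → y∈S }
    ; inWindow   = λ { first → x∈W ; last → z∈W ; low → x∈W ; high → y∈W }
    ; low<high   = x<y
    ; short      = y∸x<d
    ; first<last = <-trans x<y y<z
    ; long       = d≤spread
    }
    where
    x∈W = inWindow-cell t scale (toℕ x) ≤-refl (<⇒≤ (<-trans x<y y<z))
    y∈W = inWindow-cell t scale (toℕ y) (<⇒≤ x<y) (<⇒≤ y<z)
    z∈W = inWindow-cell t scale (toℕ z) (<⇒≤ (<-trans x<y y<z)) ≤-refl
  ... | no y∸x≮d = record
    { point      = λ { first → x ; last → z ; low → y ; high → z }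
    ; point∈     = λ { first → x∈S ; last → z∈S ; low → y∈S ; high → z∈S }
    ; inWindow   = λ { first → x∈W ; last → z∈W ; low → y∈W ; high → z∈W }
    ; low<high   = y<z
    ; short      = +-cancelʳ-< d _ d (begin-strict
        toℕ z ∸ toℕ y + d                 ≤⟨ +-monoʳ-≤ (toℕ z ∸ toℕ y) (≮⇒≥ y∸x≮d) ⟩
        toℕ z ∸ toℕ y + (toℕ y ∸ toℕ x)   ≡⟨ +-∸-assoc (toℕ z ∸ toℕ y) (<⇒≤ x<y) ⟨
        (toℕ z ∸ toℕ y + toℕ y) ∸ toℕ x   ≡⟨ cong (_∸ toℕ x) (m∸n+n≡m (<⇒≤ y<z)) ⟩
        toℕ z ∸ toℕ x                     <⟨ spread<2d ⟩
        2 * d                             ≡⟨ cong (d +_) (+-identityʳ d) ⟩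
        d + d                             ∎)
    ; first<last = <-trans x<y y<z
    ; long       = d≤spread
    }
    where
    x∈W = inWindow-cell t scale (toℕ x) ≤-refl (<⇒≤ (<-trans x<y y<z))
    y∈W = inWindow-cell t scale (toℕ y) (<⇒≤ x<y) (<⇒≤ y<z)
    z∈W = inWindow-cell t scale (toℕ z) (<⇒≤ (<-trans x<y y<z)) ≤-refl

  -- Equal residue and cell put both first points in the same block of length `d`. But the later
  -- triple starts beyond the z of the earlier one, which is at least `d` past the start of that
  -- block.
  cell-injective : ∀ {s t} → HasScale s → s ≺ t → residue s ≡ residue t → cell s ≢ cell t
  cell-injective {s} {t} (d≤spread , _) z<x′ r≡r′ c≡c′ = <-irrefl refl (begin-strict
    toℕ (Triple.x t)              <⟨ x<[q+1]d (toℕ (Triple.x t)) ⟩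
    toℕ (Triple.x t) / d * d + d  ≡⟨ cong (_+ d) (begin-equality
      toℕ (Triple.x t) / d * d                     ≡⟨ base-cell t ⟨
      residue t * d + toℕ (cell t) * (2 * (3 * d)) ≡⟨ cong₂ (λ r c → r * d + toℕ c * (2 * (3 * d))) r≡r′ c≡c′ ⟨
      residue s * d + toℕ (cell s) * (2 * (3 * d)) ≡⟨ base-cell s ⟩
      toℕ (Triple.x s) / d * d                     ∎) ⟩
    toℕ (Triple.x s) / d * d + d  ≤⟨ +-mono-≤ (m/n*n≤m (toℕ (Triple.x s)) d) d≤spread ⟩
    toℕ (Triple.x s) + (toℕ (Triple.z s) ∸ toℕ (Triple.x s)) ≡⟨ m+[n∸m]≡n (<⇒≤ (<-trans (Triple.x<y s) (Triple.y<z s))) ⟩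
    toℕ (Triple.z s)              <⟨ z<x′ ⟩
    toℕ (Triple.x t)              ∎)

-- Counting triples by residue and scale.

module _
  (π : Permutation′ (suc (suc k))) (π′ : Permutation′ k)
  (apart : OneTwoNonAdjacent π) (norm : IsNormalization π′ (removeOneTwo π))
  {S : Subset n} (avoids : ¬ ContainsWave π n S)
  {b : ℕ} (bound : ∀ U → ¬ ContainsWave π′ n U → ∣ U ∣ ≤ b)
  where

  open ≤-Reasoning

  class-bound : ∀ d .{{_ : NonZero d}} r (ts : List (Triple S)) → AllPairs _≺_ ts →
    All (HasScale d) ts → All (λ t → residue d t ≡ r) ts → length ts ≤ b
  class-bound d r ts ts! scales residues = begin
    length ts                ≡⟨ length-map (cell d) ts ⟨
    length (map (cell d) ts) ≤⟨ unique⇒length≤∣S∣ U _ (distinct ts! scales residues) (∈-fromElements⁺ _) ⟩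
    ∣ U ∣                    ≤⟨ bound U U-avoids ⟩
    b                        ∎
    where
    U = fromElements (map (cell d) ts)

    distinct : ∀ {ts} → AllPairs _≺_ ts → All (HasScale d) ts → All (λ t → residue d t ≡ r) ts →
      AllPairs _≢_ (map (cell d) ts)
    distinct [] [] [] = []
    distinct {s ∷ _} (s≺ ∷ ts!) (h ∷ hs) (r≡ ∷ rs) =
      Allₚ.map⁺ (All.zipWith
        (λ {t} (s≺t , r′≡) → cell-injective d {s} {t} h s≺t (trans r≡ (sym r′≡))) (s≺ , rs)) ∷
      distinct ts! hs rs

    U-avoids : ¬ ContainsWave π′ n U
    U-avoids (y , y∈U , wave) = avoids (expand-π′-wave π π′ apart norm y wave clusters)
      where
      clusters : ∀ i → Cluster S d (r * d) (3 * d) (toℕ (y i))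
      clusters i =
        let (t , t∈ , c≡y) = ∈-fromElements⁻ (cell d) ts (y∈U i)
        -- The common residue `r` gives all clusters the same offset, so they belong to one system
        -- of windows.
        in subst₂ (λ r u → Cluster S d (r * d) (3 * d) (toℕ u)) (All.lookup residues t∈) c≡y
             (cluster d t (All.lookup scales t∈))

  scale-bound : ∀ d .{{_ : NonZero d}} (ts : List (Triple S)) → AllPairs _≺_ ts →
    All (HasScale d) ts → length ts ≤ 6 * b
  scale-bound d ts ts! scales =
    pigeonhole 6 b (residue d) ts (All.universal (λ t → m%n<n (toℕ (Triple.x t) / d) 6) ts)
      (λ r → let r? = λ t → residue d t ≟ r in
        class-bound d r (filter r? ts)
          (AllPairsₚ.filter⁺ r? ts!) (Allₚ.filter⁺ r? scales) (Allₚ.all-filter r? ts))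

  -- A spread is below `n`, so only the `l` levels from 0 to l - 1 occur.
  triples-bound : ∀ l → n < 2 ^ l → (ts : List (Triple S)) → AllPairs _≺_ ts → length ts ≤ l * (6 * b)
  triples-bound l n<2^l ts ts! =
    pigeonhole l (6 * b) level ts (All.universal level<l ts)
      (λ j → let j? = λ t → level t ≟ j in
        scale-bound (2 ^ j) {{m^n≢0 2 j}} (filter j? ts) (AllPairsₚ.filter⁺ j? ts!)
          (All.map (λ { {t} refl → proj₂ (scale t) }) (Allₚ.all-filter j? ts)))
    where
    scale : (t : Triple S) → ∃ λ j → 2 ^ j ≤ Triple.spread t × Triple.spread t < 2 ^ suc j
    scale t = dyadic (Triple.spread t) (m<n⇒0<n∸m (<-trans (Triple.x<y t) (Triple.y<z t)))

    level : Triple S → ℕ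
    level = proj₁ ∘ scale

    level<l : ∀ t → level t < l
    level<l t = ≰⇒> λ l≤level → <-irrefl refl (begin-strict
      n                                      <⟨ n<2^l ⟩
      2 ^ l                                  ≤⟨ ^-monoʳ-≤ 2 l≤level ⟩
      2 ^ level t                            ≤⟨ proj₁ (proj₂ (scale t)) ⟩
      toℕ (Triple.z t) ∸ toℕ (Triple.x t)    ≤⟨ m∸n≤m _ (toℕ (Triple.x t)) ⟩
      toℕ (Triple.z t)                       <⟨ Finₚ.toℕ<n (Triple.z t) ⟩
      n                                      ∎)

  size-bound : ∀ l → n < 2 ^ l → ∣ S ∣ ≤ 2 + l * (6 * b) * 3
  size-bound l n<2^l = begin
    ∣ S ∣                 ≡⟨ length-elements S ⟨
    length (elements S)   ≤⟨ length≤triples (elements S) S! S∈ ⟩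
    2 + length ts * 3     ≤⟨ +-monoʳ-≤ 2 (*-monoˡ-≤ 3 (triples-bound l n<2^l ts (triples-sorted _ S! S∈))) ⟩
    2 + l * (6 * b) * 3   ∎
    where
    S! = elements-sorted S
    S∈ = elements-∈ S
    ts = triples (elements S) S! S∈

-- Constants and conclusion.

singleton-avoids : (σ : Permutation′ (suc m)) (i : Fin n) → ¬ ContainsWave σ n ⁅ i ⁆
singleton-avoids σ i (x , x∈ , x↑ , _) =
  <-irrefl (cong (suc ∘ toℕ) (trans (x∈⁅y⁆⇒x≡y i (x∈ Fin.zero)) (sym (x∈⁅y⁆⇒x≡y i (x∈ (Fin.suc Fin.zero))))))
    (x↑ Fin.zero)

-- For l, b ≥ 1 the left side 2 + 18(l + 1)b is at most (2 + 18 + 18)lb = 38lb. The substitution of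
-- successors makes the slack an explicit polynomial.
constants : ∀ l b → 0 < l → 0 < b → 2 + suc l * (6 * b) * 3 ≤ l * (42 * b)
constants (suc l) (suc b) _ _ = subst (lhs ≤_) (sym (slack l b)) (m≤m+n lhs _)
  where
  lhs = 2 + suc (suc l) * (6 * suc b) * 3
  slack : ∀ l b → suc l * (42 * suc b) ≡
    2 + suc (suc l) * (6 * suc b) * 3 + (4 + 6 * b + 24 * l * suc b)
  slack = solve-∀

no-apart-in-S₂ : (π : Permutation′ 2) → ¬ OneTwoNonAdjacent π
no-apart-in-S₂ π apart =
  contradiction (≤-trans apart (∣i-j∣≤1 (π ⟨$⟩ˡ Fin.zero) (π ⟨$⟩ˡ Fin.suc Fin.zero))) λ { (s≤s ()) }
  where
  ∣i-j∣≤1 : (i j : Fin 2) → ∣ toℕ i - toℕ j ∣ ≤ 1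
  ∣i-j∣≤1 Fin.zero           Fin.zero           = z≤n
  ∣i-j∣≤1 Fin.zero           (Fin.suc Fin.zero) = ≤-refl
  ∣i-j∣≤1 (Fin.suc Fin.zero) Fin.zero           = ≤-refl
  ∣i-j∣≤1 (Fin.suc Fin.zero) (Fin.suc Fin.zero) = z≤n

-- Exponentiation replaces the real logarithm: the conclusion is a ≤ 42 (log₂ n) b with both sides
-- as exponents of 2.
theorem1p12 : (k : ℕ) (π : Permutation′ (suc (suc k))) (π′ : Permutation′ k) →
    OneTwoNonAdjacent π → IsNormalization π′ (removeOneTwo π) →
    (n : ℕ) → 1 < n → (a b : ℕ) → IsG π n a → IsG π′ n b →
    2 ^ a ≤ n ^ (42 * b)
theorem1p12 zero π π′ apart norm n 1<n a b _ _ = contradiction apart (no-apart-in-S₂ π)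
theorem1p12 (suc k) π π′ apart norm n 1<n a b ((S , avoids , ∣S∣≡a) , _) (_ , bound) =
  -- The upper bound on `n` limits the scales to l + 1 many; the lower bound turns the resulting
  -- multiple of `l` back into a power of `n`.
  let (l , 2^l≤n , n<2^[1+l]) = dyadic n (<-trans z<s 1<n)
  in begin
    2 ^ a              ≤⟨ ^-monoʳ-≤ 2 (a≤ l n<2^[1+l]) ⟩
    2 ^ (l * (42 * b)) ≡⟨ ^-*-assoc 2 l (42 * b) ⟨
    (2 ^ l) ^ (42 * b) ≤⟨ ^-monoˡ-≤ (42 * b) 2^l≤n ⟩
    n ^ (42 * b)       ∎
  where
  open ≤-Reasoning

  0<b : 0 < b
  -- Here π′ has at least one entry, so its waves have at least two points and a singleton avoids
  -- them.
  0<b = subst (_≤ b) (∣⁅x⁆∣≡1 (fromℕ< 1<n)) (bound ⁅ fromℕ< 1<n ⁆ (singleton-avoids π′ (fromℕ< 1<n)))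

  0<log : ∀ l → n < 2 ^ suc l → 0 < l
  0<log zero    n<2 = contradiction n<2 (≤⇒≯ 1<n)
  0<log (suc l) _   = z<s

  a≤ : ∀ l → n < 2 ^ suc l → a ≤ l * (42 * b)
  a≤ l n<2^[1+l] = begin
    a                          ≡⟨ ∣S∣≡a ⟨
    ∣ S ∣                      ≤⟨ size-bound π π′ apart norm avoids bound (suc l) n<2^[1+l] ⟩
    2 + suc l * (6 * b) * 3    ≤⟨ constants l b (0<log l n<2^[1+l]) 0<b ⟩
    l * (42 * b)               ∎
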